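{- There exist constants $c>0$ and $n_0$ such that for every $n\ge n_0$ there exists a graph $G$ on $n$ vertices with at least $c\,n\frac{\log n}{\log\log n}$ edges whose separation dimension is at most $4$.
   Context: For points $x,y\in\mathbb{R}^d$, let $b(x,y)$ denote the (closed) axis-parallel box spanned by $x$ and $y$, i.e. the smallest set $\prod_{i=1}^d[a_i,b_i]$ containing both. The separation dimension of a graph $G$ is the smallest $d$ for which there is a map $\phi:V(G)\to\mathbb{R}^d$ such that whenever $\{x,y\}$ and $\{x',y'\}$ are disjoint edges of $G$ (no common endpoint), the boxes $b(\phi(x),\phi(y))$ and $b(\phi(x'),\phi(y'))$ are disjoint. -}

module Defs where

open import Data.Nat using (ℕ; suc; _≤_)
open import Data.Nat.Logarithm using (⌊log₂_⌋)
open import Data.Integer using (+_)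
open import Data.Rational using (ℚ; _/_; _⊓_; _⊔_) renaming (_≤_ to _≤ℚ_)
open import Data.Fin using (Fin) renaming (_<_ to _<ᶠ_)
open import Data.Product using (_×_; _,_; Σ; ∃-syntax)
open import Data.List using (List; length)
open import Data.List.Membership.Propositional using (_∈_)
open import Data.List.Relation.Unary.All using (All)
open import Data.List.Relation.Unary.Unique.Propositional using (Unique)
open import Relation.Binary.PropositionalEquality using (_≢_)
open import Relation.Nullary using (¬_)

-- A finite simple graph on the vertex set Fin n: a duplicate-free list of
-- edges, each edge {a,b} stored once as the pair (a , b) with a < b.
record Graph (n : ℕ) : Set where
  field
    edges   : List (Fin n × Fin n)
    ordered : All (λ e → Data.Product.proj₁ e <ᶠ Data.Product.proj₂ e) edges
    unique  : Unique edges
open Graph public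

∣E∣ : ∀ {n} → Graph n → ℕ
∣E∣ G = length (edges G)

Point : ℕ → Set
Point d = Fin d → ℚ

_∈box_ : ∀ {d} → Point d → Point d × Point d → Set
p ∈box (x , y) = ∀ i → ((x i ⊓ y i) ≤ℚ p i) × (p i ≤ℚ (x i ⊔ y i))

BoxesDisjoint : ∀ {d} → Point d × Point d → Point d × Point d → Set
BoxesDisjoint {d} b b′ = (p : Point d) → ¬ (p ∈box b × p ∈box b′)

EdgesDisjoint : ∀ {n} → Fin n × Fin n → Fin n × Fin n → Set
EdgesDisjoint (a , b) (a′ , b′) = (a ≢ a′) × (a ≢ b′) × (b ≢ a′) × (b ≢ b′)

Separating : ∀ {n} (d : ℕ) → Graph n → (Fin n → Point d) → Set
Separating d G φ =
  ∀ {a b a′ b′} → (a , b) ∈ edges G → (a′ , b′) ∈ edges G →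
  EdgesDisjoint (a , b) (a′ , b′) →
  BoxesDisjoint (φ a , φ b) (φ a′ , φ b′)

SepDimAtMost : ∀ {n} → ℕ → Graph n → Set
SepDimAtMost {n} k G = ∃[ d ] (d ≤ k) × Σ (Fin n → Point d) (Separating d G)

ℕ→ℚ : ℕ → ℚ
ℕ→ℚ m = + m / 1

{-# OPTIONS --safe #-}

-- The graph is the incidence graph of a system of points and axis-parallel
-- rectangles in the plane in which two points lie in at most one common rectangle
-- (Tomon and Zakharov).  Place a point (x , y) at (x , x , y , y) and a rectangle
-- [l , r] × [b , t] at (l , r , b , t).  If p ∈ R and p′ ∈ R′ are disjoint edges,
-- then p ∉ R′ or p′ ∉ R; a side of R′ that has p on its wrong side gives a
-- coordinate separating the two boxes.
--
-- The system is the one of Basit, Chernikov, Starchenko, Tao and Tran: the points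
-- are the elements of m copies of [b]^k, the rectangles are the axis-parallel lines.
-- The digits of a point are read in opposite orders for x and for y, so that the
-- points agreeing with a given one in all digits but one are cut out by a rectangle.
-- Here k = b ≈ log n / (3 log log n), and m ≈ n / (2 b^b).

module Submission where

open import Defs
open import Data.Nat using (ℕ; _≤_; _*_)
open import Data.Nat.Logarithm using (⌊log₂_⌋)
open import Data.Rational using (ℚ; Positive) renaming (_≤_ to _≤ℚ_; _*_ to _*ℚ_)
open import Data.Product using (_×_; ∃-syntax)

open import Data.Empty using (⊥; ⊥-elim)
open import Data.Fin using (Fin; zero; suc; toℕ; splitAt; _↑ˡ_; _↑ʳ_)
open import Data.Fin.Properties
  using (toℕ<n; toℕ≤pred[n]; toℕ-injective; toℕ-↑ˡ; toℕ-↑ʳ; splitAt-↑ˡ; splitAt-↑ʳ;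
         ↑ˡ-injective; ↑ʳ-injective; 0↔⊥; +↔⊎; *↔×)
open import Data.Integer as ℤ using (+_; +≤+; +<+)
import Data.Integer.Properties as ℤ
open import Data.List using (List; []; _∷_; _++_; map; length; allFin; cartesianProductWith)
open import Data.List.Membership.Propositional using (_∈_)
open import Data.List.Membership.Propositional.Properties
  using (∈-map⁻; ∈-++⁻; ∈-cartesianProductWith⁻)
open import Data.List.Properties using (length-map; length-++; length-tabulate)
import Data.List.Relation.Unary.All as All
import Data.List.Relation.Unary.All.Properties as All
open import Data.List.Relation.Unary.Unique.Propositional using (Unique; [])
import Data.List.Relation.Unary.Unique.Propositional.Properties as Unique
open import Data.Nat
  using (zero; suc; _+_; _∸_; _^_; _<_; _/_; _%_; _≤?_; ⌊_/2⌋; ⌈_/2⌉; z≤n; s≤s; NonZero; >-nonZero)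
open import Data.Nat.DivMod using (m≡m%n+[m/n]*n; m%n<n; m/n*n≤m; m≥n⇒m/n>0)
open import Data.Nat.Induction using (<-rec)
open import Data.Nat.Logarithm using (⌊log₂⌋-mono-≤; ⌊log₂⌊n/2⌋⌋≡⌊log₂n⌋∸1; ⌊log₂[2^n]⌋≡n)
open import Data.Nat.Properties
open import Data.Nat.Tactic.RingSolver using (solve-∀)
open import Data.Product using (_,_; proj₁; proj₂)
open import Data.Product.Function.NonDependent.Propositional using (_×-↔_)
open import Data.Rational using (_⊓_; _⊔_; toℚᵘ) renaming (_<_ to _<ℚ_; _/_ to _/ℚ_)
import Data.Rational.Properties as ℚ
open import Data.Rational.Unnormalised as ℚᵘ using (ℚᵘ; mkℚᵘ; *≤*; *<*)
import Data.Rational.Unnormalised.Properties as ℚᵘ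
open import Data.Sum using (_⊎_; inj₁; inj₂; [_,_]′; swap)
open import Data.Sum.Function.Propositional using (_⊎-↔_)
open import Data.Vec using (lookup; []; _∷_)
open import Function using (_∘_; _↔_; Inverse)
open import Function.Construct.Composition using (_↔-∘_)
open import Function.Construct.Identity using (↔-id)
open import Function.Construct.Symmetry using (↔-sym)
open import Function.Properties.Inverse using (↔⇒↣)
open import Function.Bundles using (Injection)
open import Relation.Binary.PropositionalEquality
  using (_≡_; _≢_; refl; sym; trans; cong; cong₂; subst; subst₂; module ≡-Reasoning)
open import Relation.Nullary using (Dec; yes; no; ¬_)
open import Relation.Nullary.Decidable using (_×-dec_)

-- Enumerations and leading digits.

length-cartesianProductWith : ∀ {A B C : Set} (f : A → B → C) xs ys →
  length (cartesianProductWith f xs ys) ≡ length xs * length ys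
length-cartesianProductWith f []       ys = refl
length-cartesianProductWith f (x ∷ xs) ys =
  trans (length-++ (map (f x) ys))
        (cong₂ _+_ (length-map (f x) ys) (length-cartesianProductWith f xs ys))

enumerate : ∀ {A : Set} {p} → A ↔ Fin p → List A
enumerate A↔p = map (Inverse.from A↔p) (allFin _)

length-enumerate : ∀ {A : Set} {p} (A↔p : A ↔ Fin p) → length (enumerate A↔p) ≡ p
length-enumerate A↔p = trans (length-map (Inverse.from A↔p) (allFin _)) (length-tabulate (λ i → i))

enumerate-unique : ∀ {A : Set} {p} (A↔p : A ↔ Fin p) → Unique (enumerate A↔p)
enumerate-unique A↔p =
  Unique.map⁺ (Injection.injective (↔⇒↣ (↔-sym A↔p))) (Unique.allFin⁺ _)

-- Since `s < w`, the right-hand side stays below `suc b * w`. In `Extend` this recovers comparisons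
-- of digits from comparisons of coordinates.
leading-digit-≤ : ∀ {w a b r s} → s < w → a * w + r ≤ b * w + s → a ≤ b
leading-digit-≤ {w} {a} {b} {r} {s} s<w le = m<1+n⇒m≤n (*-cancelʳ-< w a (suc b) (begin-strict
  a * w      ≤⟨ m≤m+n (a * w) r ⟩
  a * w + r  ≤⟨ le ⟩
  b * w + s  <⟨ +-monoʳ-< (b * w) s<w ⟩
  b * w + w  ≡⟨ +-comm (b * w) w ⟩
  suc b * w  ∎))
  where open ≤-Reasoning

-- Systems of points and rectangles

record PointsAndRectangles (p r : ℕ) : Set₁ where
  field
    Pt Rect : Set
    Pt↔     : Pt ↔ Fin p
    Rect↔   : Rect ↔ Fin r
    x y     : Pt → ℕ
    left right bottom top : Rect → ℕ

  _inside_ : Pt → Rect → Set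
  q inside ρ = (left ρ ≤ x q × x q ≤ right ρ) × (bottom ρ ≤ y q × y q ≤ top ρ)

  field
    -- Place value that the next leading digit of `x` receives in `Extend`.
    width        : ℕ
    x<width      : ∀ q → x q < width
    right<width  : ∀ ρ → right ρ < width
    y-injective  : ∀ {q q′} → y q ≡ y q′ → q ≡ q′
    flags        : List (Pt × Rect)
    flags-unique : Unique flags
    flags-inside : ∀ {q ρ} → (q , ρ) ∈ flags → q inside ρ
    linear       : ∀ {q q′ ρ ρ′} → q inside ρ → q′ inside ρ → q inside ρ′ → q′ inside ρ′ →
                   q ≡ q′ ⊎ ρ ≡ ρ′

-- The base case: `m` copies of the one-point space [b]^0. The copy index behaves as one more digit,
-- trailing in `x` and leading in `y`, which stays constant along every line.
parallel-copies : ∀ m → PointsAndRectangles m 0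
parallel-copies m = record
  { Pt           = Fin m
  ; Rect         = ⊥
  ; Pt↔          = ↔-id (Fin m)
  ; Rect↔        = ↔-sym 0↔⊥
  ; x            = toℕ
  ; y            = toℕ
  ; left         = λ ()
  ; right        = λ ()
  ; bottom       = λ ()
  ; top          = λ ()
  ; width        = m
  ; x<width      = toℕ<n
  ; right<width  = λ ()
  ; y-injective  = toℕ-injective
  ; flags        = []
  ; flags-unique = []
  ; flags-inside = λ ()
  ; linear       = λ { {ρ = ()} }
  }

-- A new digit, leading in x and trailing in y.  A new rectangle inj₁ a consists of
-- the points over a; inj₂ (j , ρ) is the rectangle ρ in the layer of digit j.
module Extend {p r : ℕ} (c : ℕ) (S : PointsAndRectangles p r) where
  open PointsAndRectangles S

  Pt⁺ Rect⁺ : Set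
  Pt⁺   = Fin (suc c) × Pt
  Rect⁺ = Pt ⊎ Fin (suc c) × Rect

  x⁺ y⁺ : Pt⁺ → ℕ
  x⁺ (v , a) = toℕ v * width + x a
  y⁺ (v , a) = y a * suc c + toℕ v

  -- A fibre `inj₁ a` is pinned down by its y-interval alone, the block of `suc c` values over
  -- `y a`; its x-interval only has to reach from digit `0` to digit `c`. For `inj₂ (j , ρ)` the
  -- x-interval stays within the block of digit `j`, and adding `toℕ j` in y preserves the
  -- comparisons with `ρ`.
  left⁺ right⁺ bottom⁺ top⁺ : Rect⁺ → ℕ
  left⁺   (inj₁ a)       = x a
  left⁺   (inj₂ (j , ρ)) = toℕ j * width + left ρ
  right⁺  (inj₁ a)       = c * width + x a
  right⁺  (inj₂ (j , ρ)) = toℕ j * width + right ρ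
  bottom⁺ (inj₁ a)       = y a * suc c
  bottom⁺ (inj₂ (j , ρ)) = bottom ρ * suc c + toℕ j
  top⁺    (inj₁ a)       = y a * suc c + c
  top⁺    (inj₂ (j , ρ)) = top ρ * suc c + toℕ j

  _inside⁺_ : Pt⁺ → Rect⁺ → Set
  q inside⁺ ρ = (left⁺ ρ ≤ x⁺ q × x⁺ q ≤ right⁺ ρ) × (bottom⁺ ρ ≤ y⁺ q × y⁺ q ≤ top⁺ ρ)

  layer<width : ∀ {i z} → i ≤ c → z < width → i * width + z < suc c * width
  layer<width {i} {z} i≤c z<w = begin-strict
    i * width + z      <⟨ +-monoʳ-< (i * width) z<w ⟩
    i * width + width  ≡⟨ +-comm (i * width) width ⟩
    suc i * width      ≤⟨ *-monoˡ-≤ width (s≤s i≤c) ⟩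
    suc c * width      ∎
    where open ≤-Reasoning

  right⁺<width : ∀ ρ → right⁺ ρ < suc c * width
  right⁺<width (inj₁ a)       = layer<width ≤-refl (x<width a)
  right⁺<width (inj₂ (j , ρ)) = layer<width (toℕ≤pred[n] j) (right<width ρ)

  y⁺-injective : ∀ {q q′} → y⁺ q ≡ y⁺ q′ → q ≡ q′
  y⁺-injective {v , a} {v′ , a′} eq
    with refl ← y-injective (≤-antisym (leading-digit-≤ (toℕ<n v′) (≤-reflexive eq))
                                       (leading-digit-≤ (toℕ<n v) (≤-reflexive (sym eq))))
    = cong (_, a) (toℕ-injective (+-cancelˡ-≡ (y a * suc c) _ _ eq))

  fibre-inside⁺ : ∀ v a → (v , a) inside⁺ inj₁ a
  fibre-inside⁺ v a =
    (m≤n+m (x a) _ , +-monoˡ-≤ (x a) (*-monoˡ-≤ width (toℕ≤pred[n] v))) ,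
    (m≤m+n _ (toℕ v) , +-monoʳ-≤ (y a * suc c) (toℕ≤pred[n] v))

  layer-inside⁺ : ∀ v {a ρ} → a inside ρ → (v , a) inside⁺ inj₂ (v , ρ)
  layer-inside⁺ v ((l , r) , (b , t)) =
    (+-monoʳ-≤ (toℕ v * width) l , +-monoʳ-≤ (toℕ v * width) r) ,
    (+-monoˡ-≤ (toℕ v) (*-monoˡ-≤ (suc c) b) , +-monoˡ-≤ (toℕ v) (*-monoˡ-≤ (suc c) t))

  inside⁺-fibre : ∀ {v a a′} → (v , a) inside⁺ inj₁ a′ → a ≡ a′
  inside⁺-fibre {v} {a} {a′} (_ , (b , t)) = y-injective (≤-antisym
    (leading-digit-≤ (n<1+n c) t)
    -- The lower side of a fibre has trailing digit `0`, left unwritten in `bottom⁺`.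
    (leading-digit-≤ (toℕ<n v) (subst (_≤ y⁺ (v , a)) (sym (+-identityʳ _)) b)))

  -- The x-bounds compare leading digits both ways, which forces `v ≡ j`. The common digit then
  -- cancels in x and is dropped as the trailing one in y.
  inside⁺-layer : ∀ {v a j ρ} → (v , a) inside⁺ inj₂ (j , ρ) → v ≡ j × a inside ρ
  inside⁺-layer {v} {a} {j} {ρ} ((l , r) , (b , t))
    with refl ← toℕ-injective {i = v} {j = j}
                  (≤-antisym (leading-digit-≤ (right<width ρ) r) (leading-digit-≤ (x<width a) l))
    = refl , (+-cancelˡ-≤ (toℕ v * width) _ _ l , +-cancelˡ-≤ (toℕ v * width) _ _ r) ,
             (leading-digit-≤ (toℕ<n v) b , leading-digit-≤ (toℕ<n v) t)

  -- Fibres with a common point have the same base. A fibre fixes `a` and a layer fixes the digit,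
  -- so together they leave one point. Two layer rectangles with a common point share their digit,
  -- and linearity of `S` decides.
  linear⁺ : ∀ {q q′ ρ ρ′} → q inside⁺ ρ → q′ inside⁺ ρ → q inside⁺ ρ′ → q′ inside⁺ ρ′ →
            q ≡ q′ ⊎ ρ ≡ ρ′
  linear⁺ {ρ = inj₁ _} {inj₁ _} i₁ i₂ i₃ i₄ =
    inj₂ (cong inj₁ (trans (sym (inside⁺-fibre i₁)) (inside⁺-fibre i₃)))
  linear⁺ {ρ = inj₁ _} {inj₂ _} i₁ i₂ i₃ i₄
    with refl ← inside⁺-fibre i₁ | refl ← inside⁺-fibre i₂
       | refl , _ ← inside⁺-layer i₃ | refl , _ ← inside⁺-layer i₄ = inj₁ refl
  linear⁺ {ρ = inj₂ _} {inj₁ _} i₁ i₂ i₃ i₄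
    with refl ← inside⁺-fibre i₃ | refl ← inside⁺-fibre i₄
       | refl , _ ← inside⁺-layer i₁ | refl , _ ← inside⁺-layer i₂ = inj₁ refl
  linear⁺ {ρ = inj₂ _} {inj₂ _} i₁ i₂ i₃ i₄
    with refl , a₁ ← inside⁺-layer i₁ | refl , a₂ ← inside⁺-layer i₂
       | refl , a₃ ← inside⁺-layer i₃ | refl , a₄ ← inside⁺-layer i₄
    with linear a₁ a₂ a₃ a₄
  ... | inj₁ refl = inj₁ refl
  ... | inj₂ refl = inj₂ refl

  fibreFlag : Fin (suc c) → Pt → Pt⁺ × Rect⁺
  fibreFlag v a = (v , a) , inj₁ a

  layerFlag : Fin (suc c) → Pt × Rect → Pt⁺ × Rect⁺
  layerFlag v (a , ρ) = (v , a) , inj₂ (v , ρ)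

  fibreFlags layerFlags : List (Pt⁺ × Rect⁺)
  fibreFlags = cartesianProductWith fibreFlag (allFin (suc c)) (enumerate Pt↔)
  layerFlags = cartesianProductWith layerFlag (allFin (suc c)) flags

  flags⁺-unique : Unique (fibreFlags ++ layerFlags)
  flags⁺-unique = Unique.++⁺
    (Unique.cartesianProductWith⁺ fibreFlag (λ { refl → refl , refl })
      (Unique.allFin⁺ _) (enumerate-unique Pt↔))
    (Unique.cartesianProductWith⁺ layerFlag (λ { refl → refl , refl })
      (Unique.allFin⁺ _) flags-unique)
    disjoint
    where
    disjoint : ∀ {f} → ¬ (f ∈ fibreFlags × f ∈ layerFlags)
    disjoint (f∈₁ , f∈₂)
      with _ , _ , _ , _ , refl ← ∈-cartesianProductWith⁻ fibreFlag (allFin (suc c)) (enumerate Pt↔) f∈₁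
      with _ , _ , _ , _ , () ← ∈-cartesianProductWith⁻ layerFlag (allFin (suc c)) flags f∈₂

  flags⁺-inside : ∀ {q ρ} → (q , ρ) ∈ fibreFlags ++ layerFlags → q inside⁺ ρ
  flags⁺-inside f∈ with ∈-++⁻ fibreFlags f∈
  ... | inj₁ f∈₁
    with v , a , _ , _ , refl ← ∈-cartesianProductWith⁻ fibreFlag (allFin (suc c)) (enumerate Pt↔) f∈₁
    = fibre-inside⁺ v a
  ... | inj₂ f∈₂
    with v , _ , _ , g∈ , refl ← ∈-cartesianProductWith⁻ layerFlag (allFin (suc c)) flags f∈₂
    = layer-inside⁺ v (flags-inside g∈)

  length-flags⁺ : length (fibreFlags ++ layerFlags) ≡ suc c * p + suc c * length flags
  length-flags⁺ = begin
    length (fibreFlags ++ layerFlags)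
      ≡⟨ length-++ fibreFlags ⟩
    length fibreFlags + length layerFlags
      ≡⟨ cong₂ _+_ (length-cartesianProductWith fibreFlag (allFin (suc c)) (enumerate Pt↔))
                   (length-cartesianProductWith layerFlag (allFin (suc c)) flags) ⟩
    length (allFin (suc c)) * length (enumerate Pt↔) + length (allFin (suc c)) * length flags
      ≡⟨ cong₂ (λ s t → s * t + s * length flags)
               (length-tabulate {n = suc c} (λ i → i)) (length-enumerate Pt↔) ⟩
    suc c * p + suc c * length flags ∎
    where open ≡-Reasoning

  extend : PointsAndRectangles (suc c * p) (p + suc c * r)
  extend = record
    { Pt           = Pt⁺
    ; Rect         = Rect⁺
    ; Pt↔          = ↔-sym *↔× ↔-∘ (↔-id _ ×-↔ Pt↔)
    ; Rect↔        = ↔-sym +↔⊎ ↔-∘ (Pt↔ ⊎-↔ (↔-sym *↔× ↔-∘ (↔-id _ ×-↔ Rect↔)))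
    ; x            = x⁺
    ; y            = y⁺
    ; left         = left⁺
    ; right        = right⁺
    ; bottom       = bottom⁺
    ; top          = top⁺
    ; width        = suc c * width
    ; x<width      = λ (v , a) → layer<width (toℕ≤pred[n] v) (x<width a)
    ; right<width  = right⁺<width
    ; y-injective  = y⁺-injective
    ; flags        = fibreFlags ++ layerFlags
    ; flags-unique = flags⁺-unique
    ; flags-inside = flags⁺-inside
    ; linear       = linear⁺
    }

-- Copies of the Hamming space [b]^k and their axis-parallel lines, with `b = suc c`.

module Hamming (m c : ℕ) where

  #points #lines : ℕ → ℕ
  #points zero    = m
  #points (suc k) = suc c * #points k
  #lines zero    = 0
  #lines (suc k) = #points k + suc c * #lines k

  hamming : ∀ k → PointsAndRectangles (#points k) (#lines k)
  hamming zero    = parallel-copies m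
  hamming (suc k) = Extend.extend c (hamming k)

  #points-≡ : ∀ k → #points k ≡ suc c ^ k * m
  #points-≡ zero    = sym (*-identityˡ m)
  #points-≡ (suc k) = trans (cong (suc c *_) (#points-≡ k)) (sym (*-assoc (suc c) (suc c ^ k) m))

  private
    count-step : ∀ b k p → b * p + b * (k * p) ≡ suc k * (b * p)
    count-step = solve-∀

  -- Double counting: a line has `suc c` points, and a point lies on `k` lines, one per digit.
  #lines-≡ : ∀ k → suc c * #lines k ≡ k * #points k
  #lines-≡ zero    = *-zeroʳ (suc c)
  #lines-≡ (suc k) = begin
    suc c * (#points k + suc c * #lines k)      ≡⟨ cong (λ t → suc c * (#points k + t)) (#lines-≡ k) ⟩
    suc c * (#points k + k * #points k)         ≡⟨ *-distribˡ-+ (suc c) (#points k) _ ⟩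
    suc c * #points k + suc c * (k * #points k) ≡⟨ count-step (suc c) k (#points k) ⟩
    suc k * (suc c * #points k)                 ∎
    where open ≡-Reasoning

  #flags-≡ : ∀ k → length (PointsAndRectangles.flags (hamming k)) ≡ k * #points k
  #flags-≡ zero    = refl
  #flags-≡ (suc k) = begin
    length (PointsAndRectangles.flags (hamming (suc k)))
      ≡⟨ Extend.length-flags⁺ c (hamming k) ⟩
    suc c * #points k + suc c * length (PointsAndRectangles.flags (hamming k))
      ≡⟨ cong (λ t → suc c * #points k + suc c * t) (#flags-≡ k) ⟩
    suc c * #points k + suc c * (k * #points k)
      ≡⟨ count-step (suc c) k (#points k) ⟩
    suc k * (suc c * #points k) ∎
    where open ≡-Reasoning

-- Separation of the incidence graph

-- The fraction m/1, as `mkℚᵘ` takes the denominator minus one. Without normalisation, inequalities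
-- of fractions become inequalities of integers.
ℕ→ℚᵘ : ℕ → ℚᵘ
ℕ→ℚᵘ m = mkℚᵘ (+ m) 0

ℕ→ℚ-mono-≤ : ∀ {i j} → i ≤ j → ℕ→ℚ i ≤ℚ ℕ→ℚ j
ℕ→ℚ-mono-≤ {i} {j} i≤j = ℚ.toℚᵘ-cancel-≤ (begin
  toℚᵘ (ℕ→ℚ i)  ≃⟨ ℚ.toℚᵘ-fromℚᵘ (ℕ→ℚᵘ i) ⟩
  ℕ→ℚᵘ i        ≤⟨ *≤* (ℤ.*-monoʳ-≤-nonNeg (+ 1) (+≤+ i≤j)) ⟩
  ℕ→ℚᵘ j        ≃⟨ ℚ.toℚᵘ-fromℚᵘ (ℕ→ℚᵘ j) ⟨
  toℚᵘ (ℕ→ℚ j)  ∎)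
  where open ℚᵘ.≤-Reasoning

ℕ→ℚ-mono-< : ∀ {i j} → i < j → ℕ→ℚ i <ℚ ℕ→ℚ j
ℕ→ℚ-mono-< {i} {j} i<j = ℚ.toℚᵘ-cancel-< (begin-strict
  toℚᵘ (ℕ→ℚ i)  ≃⟨ ℚ.toℚᵘ-fromℚᵘ (ℕ→ℚᵘ i) ⟩
  ℕ→ℚᵘ i        <⟨ *<* (ℤ.*-monoʳ-<-pos (+ 1) (+<+ i<j)) ⟩
  ℕ→ℚᵘ j        ≃⟨ ℚ.toℚᵘ-fromℚᵘ (ℕ→ℚᵘ j) ⟨
  toℚᵘ (ℕ→ℚ j)  ∎)
  where open ℚᵘ.≤-Reasoning

Corner : ℕ → Set
Corner d = Fin d → ℕ

embed : ∀ {d} → Corner d → Point d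
embed u i = ℕ→ℚ (u i)

-- Corners are integral, so a separating hyperplane can be given by a threshold `k`: one box ends by
-- `k`, the other starts at `suc k` or later.
Below : ∀ {d} → Corner d × Corner d → Corner d × Corner d → Set
Below (u , v) (u′ , v′) = ∃[ i ] ∃[ k ] (u i ≤ k × v i ≤ k) × (k < u′ i × k < v′ i)

Below⇒BoxesDisjoint : ∀ {d} (u v u′ v′ : Corner d) → Below (u , v) (u′ , v′) →
  BoxesDisjoint (embed u , embed v) (embed u′ , embed v′)
Below⇒BoxesDisjoint u v u′ v′ (i , k , (u≤k , v≤k) , (k<u′ , k<v′)) p (p∈ , p∈′) =
  ℚ.<-irrefl refl (begin-strict
    p i                             ≤⟨ proj₂ (p∈ i) ⟩
    ℕ→ℚ (u i) ⊔ ℕ→ℚ (v i)           ≤⟨ ℚ.⊔-lub (ℕ→ℚ-mono-≤ u≤k) (ℕ→ℚ-mono-≤ v≤k) ⟩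
    ℕ→ℚ k                           <⟨ ℕ→ℚ-mono-< (n<1+n k) ⟩
    ℕ→ℚ (suc k)                     ≤⟨ ℚ.⊓-glb (ℕ→ℚ-mono-≤ k<u′) (ℕ→ℚ-mono-≤ k<v′) ⟩
    ℕ→ℚ (u′ i) ⊓ ℕ→ℚ (v′ i)         ≤⟨ proj₁ (p∈′ i) ⟩
    p i                             ∎)
  where open ℚ.≤-Reasoning

Separated : ∀ {d} → Corner d × Corner d → Corner d × Corner d → Set
Separated b b′ = Below b b′ ⊎ Below b′ b

Separated⇒BoxesDisjoint : ∀ {d} (u v u′ v′ : Corner d) → Separated (u , v) (u′ , v′) →
  BoxesDisjoint (embed u , embed v) (embed u′ , embed v′)
Separated⇒BoxesDisjoint u v u′ v′ (inj₁ below) = Below⇒BoxesDisjoint u v u′ v′ below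
Separated⇒BoxesDisjoint u v u′ v′ (inj₂ above) p (p∈ , p∈′) =
  Below⇒BoxesDisjoint u′ v′ u v above p (p∈′ , p∈)

module Incidence {p r : ℕ} (S : PointsAndRectangles p r) (t : ℕ) where
  open PointsAndRectangles S

  -- Points come first, which makes every edge ordered; the last `t` vertices are isolated padding.
  N : ℕ
  N = p + (r + t)

  ptVertex : Pt → Fin N
  ptVertex q = Inverse.to Pt↔ q ↑ˡ (r + t)

  rectVertex : Rect → Fin N
  rectVertex ρ = p ↑ʳ (Inverse.to Rect↔ ρ ↑ˡ t)

  edge : Pt × Rect → Fin N × Fin N
  edge (q , ρ) = ptVertex q , rectVertex ρ

  ptCorner : Pt → Corner 4
  ptCorner q = lookup (x q ∷ x q ∷ y q ∷ y q ∷ [])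

  rectCorner : Rect → Corner 4
  rectCorner ρ = lookup (left ρ ∷ right ρ ∷ bottom ρ ∷ top ρ ∷ [])

  corner : Fin N → Corner 4
  corner =
    [ ptCorner ∘ Inverse.from Pt↔
    -- Padding vertices go to the origin; they lie on no edge, so any place would do.
    , [ rectCorner ∘ Inverse.from Rect↔ , (λ _ _ → 0) ]′ ∘ splitAt r
    ]′ ∘ splitAt p

  corner-pt : ∀ q → corner (ptVertex q) ≡ ptCorner q
  corner-pt q rewrite splitAt-↑ˡ p (Inverse.to Pt↔ q) (r + t) =
    cong ptCorner (Inverse.strictlyInverseʳ Pt↔ q)

  corner-rect : ∀ ρ → corner (rectVertex ρ) ≡ rectCorner ρ
  corner-rect ρ
    rewrite splitAt-↑ʳ p (r + t) (Inverse.to Rect↔ ρ ↑ˡ t) | splitAt-↑ˡ r (Inverse.to Rect↔ ρ) t =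
    cong rectCorner (Inverse.strictlyInverseʳ Rect↔ ρ)

  ptVertex-injective : ∀ {q q′} → ptVertex q ≡ ptVertex q′ → q ≡ q′
  ptVertex-injective = Injection.injective (↔⇒↣ Pt↔) ∘ ↑ˡ-injective (r + t) _ _

  rectVertex-injective : ∀ {ρ ρ′} → rectVertex ρ ≡ rectVertex ρ′ → ρ ≡ ρ′
  rectVertex-injective = Injection.injective (↔⇒↣ Rect↔) ∘ ↑ˡ-injective t _ _ ∘ ↑ʳ-injective p _ _

  edge-ordered : ∀ f → toℕ (proj₁ (edge f)) < toℕ (proj₂ (edge f))
  edge-ordered (q , ρ)
    rewrite toℕ-↑ˡ (Inverse.to Pt↔ q) (r + t) | toℕ-↑ʳ p (Inverse.to Rect↔ ρ ↑ˡ t) =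
    <-≤-trans (toℕ<n (Inverse.to Pt↔ q)) (m≤m+n p _)

  edge-injective : ∀ {f f′} → edge f ≡ edge f′ → f ≡ f′
  edge-injective eq =
    cong₂ _,_ (ptVertex-injective (cong proj₁ eq)) (rectVertex-injective (cong proj₂ eq))

  graph : Graph N
  graph = record
    { edges   = map edge flags
    ; ordered = All.map⁺ (All.universal edge-ordered flags)
    ; unique  = Unique.map⁺ edge-injective flags-unique
    }

  outside-separated : ∀ {q ρ q′ ρ′} → q inside ρ → q′ inside ρ′ → ¬ q inside ρ′ →
    Separated (ptCorner q , rectCorner ρ) (ptCorner q′ , rectCorner ρ′)
  outside-separated {q} {ρ} {q′} {ρ′} ((l , r) , (b , t)) ((l′ , r′) , (b′ , t′)) out
    with left ρ′ ≤? x q | x q ≤? right ρ′ | bottom ρ′ ≤? y q | y q ≤? top ρ′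
  ... | yes l″ | yes r″ | yes b″ | yes t″ = ⊥-elim (out ((l″ , r″) , (b″ , t″)))
  -- Here `x q < left ρ′`. The threshold `x q` bounds `left ρ`, while `x q′` lies beyond it because
  -- `left ρ′ ≤ x q′`.
  ... | no ≰   | _      | _      | _      =
    inj₁ (zero , x q , (≤-refl , l) , (<-≤-trans (≰⇒> ≰) l′ , ≰⇒> ≰))
  -- Here `right ρ′ < x q`, and the order is reversed: the threshold `right ρ′` bounds `x q′`, and
  -- `x q ≤ right ρ` puts `right ρ` beyond it. The two cases in y are analogous.
  ... | yes _  | no ≰   | _      | _      =
    inj₂ (suc zero , right ρ′ , (r′ , ≤-refl) , (≰⇒> ≰ , <-≤-trans (≰⇒> ≰) r))
  ... | yes _  | yes _  | no ≰   | _      =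
    inj₁ (suc (suc zero) , y q , (≤-refl , b) , (<-≤-trans (≰⇒> ≰) b′ , ≰⇒> ≰))
  ... | yes _  | yes _  | yes _  | no ≰   =
    inj₂ (suc (suc (suc zero)) , top ρ′ , (t′ , ≤-refl) , (≰⇒> ≰ , <-≤-trans (≰⇒> ≰) t))

  inside? : ∀ q ρ → Dec (q inside ρ)
  inside? q ρ = (left ρ ≤? x q ×-dec x q ≤? right ρ) ×-dec (bottom ρ ≤? y q ×-dec y q ≤? top ρ)

  -- If both crossed incidences held, `q` and `q′` would lie in both rectangles, against `linear`.
  flags-separated : ∀ {q ρ q′ ρ′} → q inside ρ → q′ inside ρ′ → q ≢ q′ → ρ ≢ ρ′ →
    Separated (ptCorner q , rectCorner ρ) (ptCorner q′ , rectCorner ρ′)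
  flags-separated {q} {ρ} {q′} {ρ′} i i′ q≢q′ ρ≢ρ′ with inside? q ρ′ | inside? q′ ρ
  ... | no out | _      = outside-separated i i′ out
  ... | yes _  | no out = swap (outside-separated i′ i out)
  ... | yes j  | yes j′ = ⊥-elim ([ q≢q′ , ρ≢ρ′ ]′ (linear i j′ j i′))

  edges-separated : ∀ {a b a′ b′} → (a , b) ∈ edges graph → (a′ , b′) ∈ edges graph →
    EdgesDisjoint (a , b) (a′ , b′) → Separated (corner a , corner b) (corner a′ , corner b′)
  edges-separated e∈ e′∈ (a≢a′ , _ , _ , b≢b′)
    with (q , ρ) , f∈ , refl ← ∈-map⁻ edge e∈ | (q′ , ρ′) , f′∈ , refl ← ∈-map⁻ edge e′∈
    = subst₂ Separated (sym (corners q ρ)) (sym (corners q′ ρ′))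
        (flags-separated (flags-inside f∈) (flags-inside f′∈)
          (a≢a′ ∘ cong ptVertex) (b≢b′ ∘ cong rectVertex))
    where
    corners : ∀ q ρ → (corner (ptVertex q) , corner (rectVertex ρ)) ≡ (ptCorner q , rectCorner ρ)
    corners q ρ = cong₂ _,_ (corner-pt q) (corner-rect ρ)

  separating : Separating 4 graph (embed ∘ corner)
  separating {a} {b} {a′} {b′} e∈ e′∈ disj =
    Separated⇒BoxesDisjoint (corner a) (corner b) (corner a′) (corner b′)
      (edges-separated e∈ e′∈ disj)

incidence-graph : ∀ {p r n} (S : PointsAndRectangles p r) → p + r ≤ n →
  ∃[ G ] (∣E∣ {n} G ≡ length (PointsAndRectangles.flags S)) × SepDimAtMost 4 G
incidence-graph {p} {r} S p+r≤n =
  -- The slack between `p + r` and `n` is filled with isolated vertices.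
  let t , p+r+t≡n = m≤n⇒∃[o]m+o≡n p+r≤n
      open Incidence S t
  in subst (λ n → ∃[ G ] (∣E∣ {n} G ≡ length (PointsAndRectangles.flags S)) × SepDimAtMost 4 G)
       (trans (sym (+-assoc p r t)) p+r+t≡n)
       (graph , length-map edge (PointsAndRectangles.flags S) , 4 , ≤-refl , embed ∘ corner , separating)

-- Choice of the parameters

2*⌊n/2⌋≤n : ∀ n → 2 * ⌊ n /2⌋ ≤ n
2*⌊n/2⌋≤n n = begin
  2 * ⌊ n /2⌋            ≡⟨ cong (_+_ ⌊ n /2⌋) (+-identityʳ _) ⟩
  ⌊ n /2⌋ + ⌊ n /2⌋      ≤⟨ +-monoʳ-≤ ⌊ n /2⌋ (⌊n/2⌋≤⌈n/2⌉ n) ⟩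
  ⌊ n /2⌋ + ⌈ n /2⌉      ≡⟨ ⌊n/2⌋+⌈n/2⌉≡n n ⟩
  n                      ∎
  where open ≤-Reasoning

2^⌊log₂n⌋≤n : ∀ n → 1 ≤ n → 2 ^ ⌊log₂ n ⌋ ≤ n
2^⌊log₂n⌋≤n = <-rec _ step
  where
  open ≤-Reasoning
  step : ∀ n → (∀ {m} → m < n → 1 ≤ m → 2 ^ ⌊log₂ m ⌋ ≤ m) → 1 ≤ n → 2 ^ ⌊log₂ n ⌋ ≤ n
  step 1               _   _ = ≤-refl
  step n@(suc (suc k)) rec _ = begin
    -- Truncated subtraction makes this hold without first showing that the logarithm is positive.
    2 ^ ⌊log₂ n ⌋             ≤⟨ ^-monoʳ-≤ 2 (m≤n+m∸n ⌊log₂ n ⌋ 1) ⟩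
    2 ^ suc (⌊log₂ n ⌋ ∸ 1)   ≡⟨ cong (λ e → 2 ^ suc e) (⌊log₂⌊n/2⌋⌋≡⌊log₂n⌋∸1 n) ⟨
    2 * 2 ^ ⌊log₂ ⌊ n /2⌋ ⌋   ≤⟨ *-monoʳ-≤ 2 (rec (⌊n/2⌋<n (suc k)) (s≤s z≤n)) ⟩
    2 * ⌊ n /2⌋               ≤⟨ 2*⌊n/2⌋≤n n ⟩
    n                         ∎

2^k≤n⇒k≤⌊log₂n⌋ : ∀ k {n} → 2 ^ k ≤ n → k ≤ ⌊log₂ n ⌋
2^k≤n⇒k≤⌊log₂n⌋ k {n} le = subst (_≤ ⌊log₂ n ⌋) (⌊log₂[2^n]⌋≡n k) (⌊log₂⌋-mono-≤ le)

n<2^[1+⌊log₂n⌋] : ∀ n → n < 2 ^ suc ⌊log₂ n ⌋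
n<2^[1+⌊log₂n⌋] n = ≰⇒> (n≮n _ ∘ 2^k≤n⇒k≤⌊log₂n⌋ (suc ⌊log₂ n ⌋))

1≤⌊log₂n⌋⇒1≤n : ∀ n → 1 ≤ ⌊log₂ n ⌋ → 1 ≤ n
1≤⌊log₂n⌋⇒1≤n (suc n) _ = s≤s z≤n

-- It starts at 12 ≤ 16 and survives doubling; 9 > 8 shows that it fails at 3. For `ℓ` it gives
-- `3 * ℓ ≤ 2 ^ ℓ ≤ L`, so that the number of digits chosen in `dense-graph` is positive.
3*n≤2^n : ∀ n → 4 ≤ n → 3 * n ≤ 2 ^ n
3*n≤2^n n 4≤n with k , refl ← m≤n⇒∃[o]m+o≡n 4≤n = go k
  where
  open ≤-Reasoning
  go : ∀ k → 3 * (4 + k) ≤ 2 ^ (4 + k)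
  go zero    = m≤m+n 12 4
  go (suc k) = begin
    3 * (4 + suc k)            ≡⟨ *-distribˡ-+ 3 4 (suc k) ⟩
    -- The summand `9 + 3 * k` is exactly what is missing to twice the previous left-hand side.
    12 + 3 * suc k             ≤⟨ m≤m+n _ (9 + 3 * k) ⟩
    12 + 3 * suc k + (9 + 3 * k) ≡⟨ double k ⟩
    2 * (3 * (4 + k))          ≤⟨ *-monoʳ-≤ 2 (go k) ⟩
    2 ^ (4 + suc k)            ∎
    where
    double : ∀ k → 12 + 3 * suc k + (9 + 3 * k) ≡ 2 * (3 * (4 + k))
    double = solve-∀

-- The quotient is at least 1, so the remainder is below `d ≤ n / d * d`: rounding down loses at
-- most half.
n≤2*[n/d]*d : ∀ n d .{{_ : NonZero d}} → d ≤ n → n ≤ 2 * (n / d * d)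
n≤2*[n/d]*d n d d≤n = begin
  n                          ≡⟨ m≡m%n+[m/n]*n n d ⟩
  n % d + n / d * d          ≤⟨ +-monoˡ-≤ _ (<⇒≤ (m%n<n n d)) ⟩
  d + n / d * d              ≤⟨ +-monoˡ-≤ _ (m≤n*m d (n / d) {{>-nonZero (m≥n⇒m/n>0 d≤n)}}) ⟩
  n / d * d + n / d * d      ≡⟨ cong (_+_ (n / d * d)) (+-identityʳ _) ⟨
  2 * (n / d * d)            ∎
  where open ≤-Reasoning

-- As `b ≤ L < 2 ^ suc ℓ`, it suffices that `1 + b + ℓ * b ≤ L`. Each of the three summands is at
-- most `b * ℓ`, whence the factor 3.
digits-fit : ∀ n b → 1 ≤ n → let L = ⌊log₂ n ⌋; ℓ = ⌊log₂ L ⌋ in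
  1 ≤ b → 1 ≤ ℓ → b * (3 * ℓ) ≤ L → 2 * b ^ b ≤ n
digits-fit n b 1≤n 1≤b 1≤ℓ b*3ℓ≤L = begin
  2 * b ^ b              ≤⟨ *-monoʳ-≤ 2 (^-monoˡ-≤ b (<⇒≤ (≤-<-trans b≤L (n<2^[1+⌊log₂n⌋] L)))) ⟩
  2 * (2 ^ suc ℓ) ^ b    ≡⟨ cong (2 *_) (^-*-assoc 2 (suc ℓ) b) ⟩
  2 ^ suc (suc ℓ * b)    ≤⟨ ^-monoʳ-≤ 2 exponent ⟩
  2 ^ L                  ≤⟨ 2^⌊log₂n⌋≤n n 1≤n ⟩
  n                      ∎
  where
  open ≤-Reasoning
  L = ⌊log₂ n ⌋
  ℓ = ⌊log₂ L ⌋
  b≤L : b ≤ L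
  b≤L = begin
    b             ≤⟨ m≤m*n b (3 * ℓ) {{>-nonZero (≤-trans 1≤ℓ (m≤n*m ℓ 3))}} ⟩
    b * (3 * ℓ)   ≤⟨ b*3ℓ≤L ⟩
    L             ∎
  regroup : ∀ b ℓ → b * ℓ + (b * ℓ + ℓ * b) ≡ b * (3 * ℓ)
  regroup = solve-∀
  exponent : suc (suc ℓ * b) ≤ L
  exponent = begin
    1 + (b + ℓ * b)             ≤⟨ +-mono-≤ (*-mono-≤ 1≤b 1≤ℓ)
                                     (+-monoˡ-≤ (ℓ * b) (m≤m*n b ℓ {{>-nonZero 1≤ℓ}})) ⟩
    b * ℓ + (b * ℓ + ℓ * b)     ≡⟨ regroup b ℓ ⟩
    b * (3 * ℓ)                 ≤⟨ b*3ℓ≤L ⟩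
    L                           ∎

-- Each point has degree `b`. The 4 consists of a factor 2 for the lines, as numerous as the points,
-- and a factor 2 for rounding `m` down.
grid-graph : ∀ n b → 1 ≤ b → 2 * b ^ b ≤ n →
  ∃[ G ] (n * b ≤ 4 * ∣E∣ {n} G) × SepDimAtMost 4 G
grid-graph n b@(suc c) _ fits =
  let G , ∣E∣≡ , sep = incidence-graph (hamming b) vertices≤n in G , bound G ∣E∣≡ , sep
  where
  instance
    b^b≢0 : NonZero (b ^ b)
    b^b≢0 = m^n≢0 b b
    2b^b≢0 : NonZero (2 * b ^ b)
    2b^b≢0 = m*n≢0 2 (b ^ b)
  m = n / (2 * b ^ b)
  open Hamming m c
  open ≤-Reasoning
  regroup : ∀ s m → 2 * (s * m) ≡ m * (2 * s)
  regroup = solve-∀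
  regroup′ : ∀ s m b → 2 * (m * (2 * s)) * b ≡ 4 * (b * (s * m))
  regroup′ = solve-∀
  vertices≤n : #points b + #lines b ≤ n
  vertices≤n = begin
    -- With as many digits as values per digit, `#lines-≡` reads `b * #lines b ≡ b * #points b`.
    #points b + #lines b      ≡⟨ cong (_+_ (#points b)) (*-cancelˡ-≡ _ _ b (#lines-≡ b)) ⟩
    #points b + #points b     ≡⟨ cong (_+_ (#points b)) (+-identityʳ _) ⟨
    2 * #points b             ≡⟨ cong (2 *_) (#points-≡ b) ⟩
    2 * (b ^ b * m)           ≡⟨ regroup (b ^ b) m ⟩
    m * (2 * b ^ b)           ≤⟨ m/n*n≤m n (2 * b ^ b) ⟩
    n                         ∎
  bound : ∀ G → ∣E∣ {n} G ≡ length (PointsAndRectangles.flags (hamming b)) → n * b ≤ 4 * ∣E∣ G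
  bound G ∣E∣≡ = begin
    n * b                              ≤⟨ *-monoˡ-≤ b (n≤2*[n/d]*d n (2 * b ^ b) fits) ⟩
    2 * (m * (2 * b ^ b)) * b          ≡⟨ regroup′ (b ^ b) m b ⟩
    4 * (b * (b ^ b * m))              ≡⟨ cong (λ s → 4 * (b * s)) (#points-≡ b) ⟨
    4 * (b * #points b)                ≡⟨ cong (4 *_) (trans ∣E∣≡ (#flags-≡ b)) ⟨
    4 * ∣E∣ G                          ∎

-- The constant is 24 = 4 · 2 · 3: the 4 of `grid-graph`, a 2 for rounding `b` down, and the 3 in
-- its divisor `3 * ℓ`.
dense-graph : ∀ n → 4 ≤ ⌊log₂ ⌊log₂ n ⌋ ⌋ →
  ∃[ G ] (n * ⌊log₂ n ⌋ ≤ 24 * (∣E∣ {n} G * ⌊log₂ ⌊log₂ n ⌋ ⌋)) × SepDimAtMost 4 G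
dense-graph n 4≤ℓ = G , bound , sep
  where
  open ≤-Reasoning
  L = ⌊log₂ n ⌋
  ℓ = ⌊log₂ L ⌋
  1≤ℓ : 1 ≤ ℓ
  1≤ℓ = ≤-trans (s≤s z≤n) 4≤ℓ
  1≤L : 1 ≤ L
  1≤L = 1≤⌊log₂n⌋⇒1≤n L 1≤ℓ
  3ℓ≤L : 3 * ℓ ≤ L
  3ℓ≤L = ≤-trans (3*n≤2^n ℓ 4≤ℓ) (2^⌊log₂n⌋≤n L 1≤L)
  instance
    3ℓ≢0 : NonZero (3 * ℓ)
    3ℓ≢0 = >-nonZero (≤-trans 1≤ℓ (m≤n*m ℓ 3))
  b = L / (3 * ℓ)
  1≤b : 1 ≤ b
  1≤b = m≥n⇒m/n>0 3ℓ≤L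
  grid = grid-graph n b 1≤b
    (digits-fit n b (1≤⌊log₂n⌋⇒1≤n n 1≤L) 1≤b 1≤ℓ (m/n*n≤m L (3 * ℓ)))
  G = proj₁ grid
  sep = proj₂ (proj₂ grid)
  regroup : ∀ n b ℓ → n * (2 * (b * (3 * ℓ))) ≡ n * b * (6 * ℓ)
  regroup = solve-∀
  regroup′ : ∀ e ℓ → 4 * e * (6 * ℓ) ≡ 24 * (e * ℓ)
  regroup′ = solve-∀
  bound : n * L ≤ 24 * (∣E∣ G * ℓ)
  bound = begin
    n * L                        ≤⟨ *-monoʳ-≤ n (n≤2*[n/d]*d L (3 * ℓ) 3ℓ≤L) ⟩
    n * (2 * (b * (3 * ℓ)))      ≡⟨ regroup n b ℓ ⟩
    n * b * (6 * ℓ)              ≤⟨ *-monoˡ-≤ (6 * ℓ) (proj₁ (proj₂ grid)) ⟩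
    4 * ∣E∣ G * (6 * ℓ)          ≡⟨ regroup′ (∣E∣ G) ℓ ⟩
    24 * (∣E∣ G * ℓ)             ∎

-- The bound with a rational constant.

ℕ→ℚ-scaled-≤ : ∀ d i j → i ≤ suc d * j → ((+ 1 /ℚ suc d) *ℚ ℕ→ℚ i) ≤ℚ ℕ→ℚ j
ℕ→ℚ-scaled-≤ d i j i≤dj = ℚ.toℚᵘ-cancel-≤ (begin
  toℚᵘ ((+ 1 /ℚ suc d) *ℚ ℕ→ℚ i)
    ≃⟨ ℚ.toℚᵘ-homo-* (+ 1 /ℚ suc d) (ℕ→ℚ i) ⟩
  toℚᵘ (+ 1 /ℚ suc d) ℚᵘ.* toℚᵘ (ℕ→ℚ i)
    ≃⟨ ℚᵘ.*-cong (ℚ.toℚᵘ-fromℚᵘ (mkℚᵘ (+ 1) d)) (ℚ.toℚᵘ-fromℚᵘ (ℕ→ℚᵘ i)) ⟩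
  mkℚᵘ (+ 1) d ℚᵘ.* ℕ→ℚᵘ i
    ≤⟨ *≤* (subst₂ ℤ._≤_ lhs rhs (+≤+ i≤dj)) ⟩
  ℕ→ℚᵘ j
    ≃⟨ ℚ.toℚᵘ-fromℚᵘ (ℕ→ℚᵘ j) ⟨
  toℚᵘ (ℕ→ℚ j) ∎)
  where
  open ℚᵘ.≤-Reasoning
  -- The order on unnormalised fractions is cross-multiplication; `lhs` and `rhs` bring the
  -- hypothesis into that form.
  lhs : + i ≡ (+ 1 ℤ.* + i) ℤ.* + 1
  lhs = sym (trans (ℤ.*-identityʳ _) (ℤ.*-identityˡ (+ i)))
  rhs : + (suc d * j) ≡ + j ℤ.* + (suc d * 1)
  rhs = trans (cong +_ (trans (*-comm (suc d) j) (cong (j *_) (sym (*-identityʳ (suc d))))))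
              (ℤ.pos-* j (suc d * 1))

theorem4 : ∃[ c ] Positive c × ∃[ n₀ ] ((n : ℕ) → n₀ ≤ n →
    ∃[ G ] ((c *ℚ ℕ→ℚ (n * ⌊log₂ n ⌋)) ≤ℚ ℕ→ℚ (∣E∣ {n} G * ⌊log₂ ⌊log₂ n ⌋ ⌋)
    × SepDimAtMost 4 G))
-- From `n ≥ 2 ^ (2 ^ 4)` the logarithm is at least 16 and the iterated one at least 4. The argument
-- 23 below stands for the denominator 24.
theorem4 = + 1 /ℚ 24 , _ , 2 ^ (2 ^ 4) , λ n n≥n₀ →
  let G , bound , sep = dense-graph n (2^k≤n⇒k≤⌊log₂n⌋ 4 (2^k≤n⇒k≤⌊log₂n⌋ (2 ^ 4) n≥n₀))
  in G , ℕ→ℚ-scaled-≤ 23 (n * ⌊log₂ n ⌋) (∣E∣ G * ⌊log₂ ⌊log₂ n ⌋ ⌋) bound , sep
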